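{- Let $n\ge 5$, $k\in\{2,\dots,n-2\}$, and let $P,Q$ be generic planar $n$-gons such that $Q$ is inscribed in $P$ and $T_k(Q)$ is inscribed in $T_k(P)$. Then $T_k^2(Q)$ is inscribed in $T_k^2(P)$, and consequently $T_k^m(Q)$ is inscribed in $T_k^m(P)$ for every $m\ge 1$.
   Context: For an $n$-gon $P=(P_i)_{i\in\mathbb Z/n}$ in the projective plane and $k\in\{2,\dots,n-2\}$, the $k$-diagonal pentagram map is $T_k(P)=P'$ with $P'_i=P_iP_{i+k}\cap P_{i+1}P_{i+k+1}$ (here $XY$ is the line through $X,Y$). For $k=2$ this is Schwartz's pentagram map. A polygon $Q$ with the same number of vertices as $P$ is inscribed in $P$ if $Q_i$ lies on the line $P_iP_{i+1}$ for all $i$. "Generic" means that all iterates considered are well defined. -}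

module Defs where

open import Algebra.Apartness.Bundles using (HeytingField)
open import Data.Fin.Base using (Fin; toℕ)
open import Data.Fin.Patterns using (0F; 1F; 2F)
open import Data.Fin.Properties using (nonZeroIndex)
open import Data.Nat.Base as ℕ using (ℕ; zero; suc)
open import Data.Nat.DivMod using (_mod_)
open import Data.Product.Base using (Σ-syntax; ∃-syntax; _×_; _,_)
open import Data.Unit.Base using (⊤)
open import Data.Vec.Functional using (Vector; []; _∷_)
open import Level using (Level; Lift; _⊔_)

-- Vertices are indexed by Fin n, read as ℤ/n; i ⊕ k is addition modulo n.
infixl 6 _⊕_
_⊕_ : ∀ {n} → Fin n → ℕ → Fin n
_⊕_ {n} i k = _mod_ (toℕ i ℕ.+ k) n {{nonZeroIndex i}}

-- Over a Heyting field "nonzero" and "distinct" are expressed by apartness.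
-- A classical (discrete) field is the case where _#_ is the negation of _≈_.
module Pentagram {c ℓ₁ ℓ₂ : Level} (F : HeytingField c ℓ₁ ℓ₂) where

  open HeytingField F

  Vec³ : Set c
  Vec³ = Vector Carrier 3

  Nonzero : Vec³ → Set ℓ₂
  Nonzero u = ∃[ i ] u i # 0#

  cross : Vec³ → Vec³ → Vec³
  cross u v = (u 1F * v 2F - u 2F * v 1F)
            ∷ (u 2F * v 0F - u 0F * v 2F)
            ∷ (u 0F * v 1F - u 1F * v 0F)
            ∷ []

  dot : Vec³ → Vec³ → Carrier
  dot u v = u 0F * v 0F + u 1F * v 1F + u 2F * v 2F

  -- A point of the projective plane, given by a representative vector of
  -- homogeneous coordinates. Lines are given by homogeneous coordinates too:
  -- the line l consists of the points X with dot X l ≈ 0#.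
  -- Everything below is invariant under rescaling the representatives.
  record Homogeneous : Set (c ⊔ ℓ₂) where
    constructor [_,_]
    field
      coords  : Vec³
      nonzero : Nonzero coords

  open Homogeneous public

  Point Line : Set (c ⊔ ℓ₂)
  Point = Homogeneous
  Line  = Homogeneous

  infix 4 _♯_ _∈ˡ_

  -- Distinctness of points (or of lines): the coordinates of the cross product
  -- are, up to sign, the 2 × 2 minors of the two coordinate vectors, so they
  -- all vanish exactly when the vectors are proportional.
  _♯_ : Homogeneous → Homogeneous → Set ℓ₂
  X ♯ Y = Nonzero (cross (coords X) (coords Y))

  _∈ˡ_ : Point → Line → Set ℓ₁
  X ∈ˡ l = dot (coords X) (coords l) ≈ 0#

  join : (X Y : Point) → X ♯ Y → Line
  join X Y X♯Y = [ cross (coords X) (coords Y) , X♯Y ]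

  meet : (l m : Line) → l ♯ m → Point
  meet l m l♯m = [ cross (coords l) (coords m) , l♯m ]

  Polygon : ℕ → Set (c ⊔ ℓ₂)
  Polygon n = Fin n → Point

  -- The lines P_i P_{i+k} and P_{i+1} P_{i+k+1} exist and are distinct.
  record DefinedAt (k : ℕ) {n : ℕ} (P : Polygon n) (i : Fin n) : Set ℓ₂ where
    field
      ends₀    : P i ♯ P (i ⊕ k)
      ends₁    : P (i ⊕ 1) ♯ P (i ⊕ (k ℕ.+ 1))
      distinct : join (P i) (P (i ⊕ k)) ends₀
               ♯ join (P (i ⊕ 1)) (P (i ⊕ (k ℕ.+ 1))) ends₁

  Defined : (k : ℕ) {n : ℕ} → Polygon n → Set ℓ₂
  Defined k P = ∀ i → DefinedAt k P i

  T : (k : ℕ) {n : ℕ} (P : Polygon n) → Defined k P → Polygon n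
  T k P d i = meet (join (P i) (P (i ⊕ k)) ends₀)
                   (join (P (i ⊕ 1)) (P (i ⊕ (k ℕ.+ 1))) ends₁)
                   distinct
    where open DefinedAt (d i)

  -- Defined^ k m P says that T_k can be applied m times in succession to P.
  Defined^ : (k m : ℕ) {n : ℕ} → Polygon n → Set ℓ₂
  Defined^ k zero    P = Lift ℓ₂ ⊤
  Defined^ k (suc m) P = Σ[ d ∈ Defined k P ] Defined^ k m (T k P d)

  T^ : (k m : ℕ) {n : ℕ} (P : Polygon n) → Defined^ k m P → Polygon n
  T^ k zero    P _        = P
  T^ k (suc m) P (d , ds) = T^ k m (T k P d) ds

  HasSides : {n : ℕ} → Polygon n → Set ℓ₂
  HasSides P = ∀ i → P i ♯ P (i ⊕ 1)

  -- That Q is inscribed in P only makes sense if the lines P_i P_{i+1} exist.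
  Inscribed : {n : ℕ} → Polygon n → Polygon n → Set (ℓ₁ ⊔ ℓ₂)
  Inscribed Q P =
    Σ[ s ∈ HasSides P ] (∀ i → Q i ∈ˡ join (P i) (P (i ⊕ 1)) (s i))

  -- All iterates of P up to T_k^m(P), and the lines through consecutive
  -- vertices of these iterates, are well defined.
  record Generic (k m : ℕ) {n : ℕ} (P : Polygon n) : Set ℓ₂ where
    field
      defined : Defined^ k m P
      sides   : ∀ j → j ℕ.≤ m → (d : Defined^ k j P) → HasSides (T^ k j P d)

  open Generic public

{-# OPTIONS --safe #-}
module Submission where

-- Write P′ = Tₖ(P) and Q′ = Tₖ(Q). The line P′ᵢP′ᵢ₊₁ is the diagonal Pᵢ₊₁Pᵢ₊ₖ₊₁, so Q″ is
-- inscribed in P″ exactly when Q′ᵢQ′ᵢ₊ₖ, P′ᵢ₊₁P′ᵢ₊ₖ₊₁ and Q′ᵢ₊₁Q′ᵢ₊ₖ₊₁ are concurrent, that is,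
-- when the triangles Q′ᵢP′ᵢ₊₁Q′ᵢ₊₁ and Q′ᵢ₊ₖP′ᵢ₊ₖ₊₁Q′ᵢ₊ₖ₊₁ are in perspective from a point.
-- Because Q′ is inscribed in P′, their sides lie on k-diagonals of P and Q, and corresponding
-- sides meet in Pᵢ₊ₖ₊₁, Pᵢ₊ₖ₊₂ and Qᵢ₊ₖ₊₁. These are collinear because Q is inscribed in P, so
-- the converse of Desargues' theorem applies. Genericity does not exclude that these triangles
-- degenerate; such cases are settled separately.

open import Defs
open import Algebra.Apartness.Bundles using (HeytingField; HeytingCommutativeRing)
import Algebra.Apartness.Properties.HeytingCommutativeRing as HeytingCommutativeRingProperties
open import Algebra.Bundles using (CommutativeRing)
open import Algebra.Solver.Ring.AlmostCommutativeRing
  using (fromCommutativeRing; _-Raw-AlmostCommutative⟶_)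
import Algebra.Solver.Ring as RingSolver
import Algebra.Properties.AbelianGroup as AbelianGroupProperties
import Algebra.Properties.Ring as RingProperties
import Algebra.Properties.Semiring.Mult as Multiplication
open import Data.Fin.Base using (Fin; toℕ; _↑ˡ_; _↑ʳ_)
open import Data.Fin.Patterns using (0F; 1F; 2F)
open import Data.Fin.Properties using (toℕ-injective; toℕ-fromℕ<)
open import Data.Integer.Base as ℤ using (ℤ; +_; -[1+_]; _⊖_; _◃_)
import Data.Integer.Properties as ℤₚ
open import Data.Maybe.Base using (Maybe; just; nothing)
open import Data.Nat.Base as ℕ using (ℕ; zero; suc; _≤_; _∸_; z≤n; s≤s)
open import Data.Nat.DivMod using (_%_; %-distribˡ-+; m%n%n≡m%n; m%n<n)
import Data.Nat.Properties as ℕₚ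
import Data.Sign.Base as Sign
open import Data.Product.Base using (_×_; ∃-syntax; _,_; proj₁; proj₂)
open import Data.Vec.Base as Vec using (Vec)
open import Data.Vec.Functional using (Vector; []; _∷_; toVec)
open import Level using (_⊔_)
open import Relation.Binary.PropositionalEquality.Core as ≡ using (_≡_)
open import Relation.Binary.PropositionalEquality.Properties using (module ≡-Reasoning)
open import Relation.Nullary.Decidable using (yes; no)
import Relation.Binary.Reasoning.Setoid as SetoidReasoning

-- Integer coefficients for the ring solver.

module IntegerSolver {c ℓ} (R : CommutativeRing c ℓ) where

  open CommutativeRing R
  open AbelianGroupProperties +-abelianGroup using (⁻¹-∙-comm; ε⁻¹≈ε; ⁻¹-involutive)
  open RingProperties ring using (-‿distribˡ-*; -‿distribʳ-*)
  open Multiplication semiring using (×-homo-+; ×1-homo-*) renaming (_×_ to _·_)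
  open SetoidReasoning setoid

  fromℤ : ℤ → Carrier
  fromℤ (+ n)    = n · 1#
  fromℤ -[1+ n ] = - (suc n · 1#)

  fromℤ-neg : ∀ i → fromℤ (ℤ.- i) ≈ - fromℤ i
  fromℤ-neg (+ 0)     = sym ε⁻¹≈ε
  fromℤ-neg (+ suc n) = refl
  fromℤ-neg -[1+ n ]  = sym (⁻¹-involutive _)

  fromℤ-⊖ : ∀ m n → fromℤ (m ⊖ n) ≈ m · 1# - n · 1#
  fromℤ-⊖ zero    zero    = sym (-‿inverseʳ 0#)
  fromℤ-⊖ zero    (suc n) = sym (+-identityˡ _)
  fromℤ-⊖ (suc m) zero    = sym (trans (+-congˡ ε⁻¹≈ε) (+-identityʳ _))
  fromℤ-⊖ (suc m) (suc n) = begin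
    fromℤ (suc m ⊖ suc n)                ≡⟨ ≡.cong fromℤ (ℤₚ.[1+m]⊖[1+n]≡m⊖n m n) ⟩
    fromℤ (m ⊖ n)                        ≈⟨ fromℤ-⊖ m n ⟩
    x - y                                ≈⟨ +-congʳ (+-identityˡ x) ⟨
    (0# + x) - y                         ≈⟨ +-congʳ (+-congʳ (-‿inverseʳ 1#)) ⟨
    ((1# - 1#) + x) - y                  ≈⟨ +-congʳ (+-assoc _ _ _) ⟩
    (1# + (- 1# + x)) - y                ≈⟨ +-congʳ (+-congˡ (+-comm _ _)) ⟩
    (1# + (x - 1#)) - y                  ≈⟨ +-congʳ (+-assoc _ _ _) ⟨
    ((1# + x) - 1#) - y                  ≈⟨ +-assoc _ _ _ ⟩
    (1# + x) + (- 1# - y)                ≈⟨ +-congˡ (⁻¹-∙-comm _ _) ⟩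
    (1# + x) - (1# + y)                  ∎
    where
    x = m · 1#
    y = n · 1#

  fromℤ-+ : ∀ i j → fromℤ (i ℤ.+ j) ≈ fromℤ i + fromℤ j
  fromℤ-+ (+ m)    (+ n)    = ×-homo-+ 1# m n
  fromℤ-+ (+ m)    -[1+ n ] = fromℤ-⊖ m (suc n)
  fromℤ-+ -[1+ m ] (+ n)    = trans (fromℤ-⊖ n (suc m)) (+-comm _ _)
  fromℤ-+ -[1+ m ] -[1+ n ] = begin
    - (suc (suc (m ℕ.+ n)) · 1#)         ≈⟨ -‿cong (+-congˡ (×-homo-+ 1# (suc m) n)) ⟩
    - (1# + (suc m · 1# + n · 1#))       ≈⟨ -‿cong (+-assoc _ _ _) ⟨
    - ((1# + suc m · 1#) + n · 1#)       ≈⟨ -‿cong (+-congʳ (+-comm _ _)) ⟩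
    - ((suc m · 1# + 1#) + n · 1#)       ≈⟨ -‿cong (+-assoc _ _ _) ⟩
    - (suc m · 1# + suc n · 1#)          ≈⟨ ⁻¹-∙-comm _ _ ⟨
    - (suc m · 1#) - (suc n · 1#)        ∎

  fromℤ-◃ : ∀ n → fromℤ (Sign.- ◃ n) ≈ - (n · 1#)
  fromℤ-◃ zero    = sym ε⁻¹≈ε
  fromℤ-◃ (suc n) = refl

  fromℤ-* : ∀ i j → fromℤ (i ℤ.* j) ≈ fromℤ i * fromℤ j
  fromℤ-* (+ m)    (+ n)    =
    trans (reflexive (≡.cong fromℤ (ℤₚ.+◃n≡+n (m ℕ.* n)))) (×1-homo-* m n)
  fromℤ-* (+ m)    -[1+ n ] = begin
    fromℤ (Sign.- ◃ (m ℕ.* suc n))       ≈⟨ fromℤ-◃ (m ℕ.* suc n) ⟩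
    - ((m ℕ.* suc n) · 1#)               ≈⟨ -‿cong (×1-homo-* m (suc n)) ⟩
    - (m · 1# * suc n · 1#)              ≈⟨ -‿distribʳ-* _ _ ⟩
    m · 1# * - (suc n · 1#)              ∎
  fromℤ-* -[1+ m ] (+ n)    = begin
    fromℤ (Sign.- ◃ (suc m ℕ.* n))       ≈⟨ fromℤ-◃ (suc m ℕ.* n) ⟩
    - ((suc m ℕ.* n) · 1#)               ≈⟨ -‿cong (×1-homo-* (suc m) n) ⟩
    - (suc m · 1# * n · 1#)              ≈⟨ -‿distribˡ-* _ _ ⟩
    - (suc m · 1#) * n · 1#              ∎
  fromℤ-* -[1+ m ] -[1+ n ] = begin
    (suc m ℕ.* suc n) · 1#               ≈⟨ ×1-homo-* (suc m) (suc n) ⟩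
    x * y                                ≈⟨ ⁻¹-involutive _ ⟨
    - - (x * y)                          ≈⟨ -‿cong (-‿distribˡ-* x y) ⟩
    - (- x * y)                          ≈⟨ -‿distribʳ-* (- x) y ⟩
    - x * - y                            ∎
    where
    x = suc m · 1#
    y = suc n · 1#

  fromℤ-morphism : ℤ.+-*-rawRing -Raw-AlmostCommutative⟶ fromCommutativeRing R
  fromℤ-morphism = record
    { ⟦_⟧    = fromℤ
    ; +-homo = fromℤ-+
    ; *-homo = fromℤ-*
    ; -‿homo = fromℤ-neg
    ; 0-homo = refl
    ; 1-homo = +-identityʳ 1#
    }

  -- Coefficients in ℤ can be compared without deciding equality in `R`. The test only ever
  -- confirms: distinct integers may have equal images in positive characteristic.
  fromℤ-≟ : ∀ i j → Maybe (fromℤ i ≈ fromℤ j)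
  fromℤ-≟ i j with i ℤₚ.≟ j
  ... | yes i≡j = just (reflexive (≡.cong fromℤ i≡j))
  ... | no  _   = nothing

  open RingSolver ℤ.+-*-rawRing (fromCommutativeRing R) fromℤ-morphism fromℤ-≟ public
    using (Polynomial; var; solve; prove; _:+_; _:*_; _:-_; :-_; _:=_)

-- Dot and cross products of homogeneous coordinates.

module VectorAlgebra {c ℓ₁ ℓ₂} (F : HeytingField c ℓ₁ ℓ₂) where

  open HeytingField F
  open Pentagram F using (Vec³; Nonzero; cross; dot)
  open HeytingCommutativeRing heytingCommutativeRing using (commutativeRing)
  open CommutativeRing commutativeRing using (+-abelianGroup; ring)
  open RingProperties ring using (-1*x≈-x)
  open AbelianGroupProperties +-abelianGroup using (ε⁻¹≈ε; ⁻¹-involutive; x∙y⁻¹≈ε⇒x≈y)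
  open HeytingCommutativeRingProperties heytingCommutativeRing
    using (x-0≈x; x#0y#0→xy#0; #-congʳ; invertibleˡ⇒#)
  open SetoidReasoning setoid
  open IntegerSolver commutativeRing

  crossᴾ : ∀ {n} → Vector (Polynomial n) 3 → Vector (Polynomial n) 3 → Vector (Polynomial n) 3
  crossᴾ u v = (u 1F :* v 2F :- u 2F :* v 1F)
             ∷ (u 2F :* v 0F :- u 0F :* v 2F)
             ∷ (u 0F :* v 1F :- u 1F :* v 0F)
             ∷ []

  dotᴾ : ∀ {n} → Vector (Polynomial n) 3 → Vector (Polynomial n) 3 → Polynomial n
  dotᴾ u v = u 0F :* v 0F :+ u 1F :* v 1F :+ u 2F :* v 2F

  -- Indeterminate vectors, to be evaluated at the entries of `coordinates`.
  𝕒 : ∀ {n} → Vector (Polynomial (3 ℕ.+ n)) 3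
  𝕒 i = var (i ↑ˡ _)

  𝕓 : ∀ {n} → Vector (Polynomial (6 ℕ.+ n)) 3
  𝕓 i = var (3 ↑ʳ (i ↑ˡ _))

  𝕔 : ∀ {n} → Vector (Polynomial (9 ℕ.+ n)) 3
  𝕔 i = var (6 ↑ʳ (i ↑ˡ _))

  𝕕 : ∀ {n} → Vector (Polynomial (12 ℕ.+ n)) 3
  𝕕 i = var (9 ↑ʳ (i ↑ˡ _))

  coordinates : ∀ {m} → Vec Vec³ m → Vec Carrier (m ℕ.* 3)
  coordinates us = Vec.concat (Vec.map toVec us)

  pattern ⟨_∣_⟩ u v         = u Vec.∷ v Vec.∷ Vec.[]
  pattern ⟨_∣_∣_⟩ u v w     = u Vec.∷ v Vec.∷ w Vec.∷ Vec.[]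
  pattern ⟨_∣_∣_∣_⟩ u v w x = u Vec.∷ v Vec.∷ w Vec.∷ x Vec.∷ Vec.[]

  dot-comm : ∀ u v → dot u v ≈ dot v u
  dot-comm u v = prove (coordinates ⟨ u ∣ v ⟩) (dotᴾ 𝕒 𝕓) (dotᴾ 𝕓 𝕒) refl

  dot-crossˡ : ∀ u v → dot u (cross u v) ≈ 0#
  dot-crossˡ u v = trans
    -- `𝕒 0F :- 𝕒 0F` stands in for the zero polynomial.
    (prove (coordinates ⟨ u ∣ v ⟩) (dotᴾ 𝕒 (crossᴾ 𝕒 𝕓)) (𝕒 0F :- 𝕒 0F) refl)
    (-‿inverseʳ _)

  dot-crossʳ : ∀ u v → dot v (cross u v) ≈ 0#
  dot-crossʳ u v = trans
    (prove (coordinates ⟨ u ∣ v ⟩) (dotᴾ 𝕓 (crossᴾ 𝕒 𝕓)) (𝕒 0F :- 𝕒 0F) refl)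
    (-‿inverseʳ _)

  cross-anticomm : ∀ u v i → cross u v i ≈ - cross v u i
  cross-anticomm u v 0F = prove (coordinates ⟨ u ∣ v ⟩) (crossᴾ 𝕒 𝕓 0F) (:- crossᴾ 𝕓 𝕒 0F) refl
  cross-anticomm u v 1F = prove (coordinates ⟨ u ∣ v ⟩) (crossᴾ 𝕒 𝕓 1F) (:- crossᴾ 𝕓 𝕒 1F) refl
  cross-anticomm u v 2F = prove (coordinates ⟨ u ∣ v ⟩) (crossᴾ 𝕒 𝕓 2F) (:- crossᴾ 𝕓 𝕒 2F) refl

  -- `dot (cross u v) w` is the determinant of the three vectors: it vanishes when the points are
  -- collinear or, dually, the lines concurrent.
  dot-cross-cycle : ∀ u v w → dot (cross u v) w ≈ dot (cross v w) u
  dot-cross-cycle u v w = prove (coordinates ⟨ u ∣ v ∣ w ⟩)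
    (dotᴾ (crossᴾ 𝕒 𝕓) 𝕔) (dotᴾ (crossᴾ 𝕓 𝕔) 𝕒) refl

  dot-cross-swap : ∀ u v w → dot (cross u v) w ≈ - dot (cross u w) v
  dot-cross-swap u v w = prove (coordinates ⟨ u ∣ v ∣ w ⟩)
    (dotᴾ (crossᴾ 𝕒 𝕓) 𝕔) (:- dotᴾ (crossᴾ 𝕒 𝕔) 𝕓) refl

  dot-cross-reverse : ∀ u v w → dot (cross u v) w ≈ - dot (cross w v) u
  dot-cross-reverse u v w = prove (coordinates ⟨ u ∣ v ∣ w ⟩)
    (dotᴾ (crossᴾ 𝕒 𝕓) 𝕔) (:- dotᴾ (crossᴾ 𝕔 𝕓) 𝕒) refl

  cross-cross : ∀ u v w i → cross (cross u v) w i ≈ v i * dot u w - u i * dot v w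
  cross-cross u v w 0F = prove (coordinates ⟨ u ∣ v ∣ w ⟩)
    (crossᴾ (crossᴾ 𝕒 𝕓) 𝕔 0F) (𝕓 0F :* dotᴾ 𝕒 𝕔 :- 𝕒 0F :* dotᴾ 𝕓 𝕔) refl
  cross-cross u v w 1F = prove (coordinates ⟨ u ∣ v ∣ w ⟩)
    (crossᴾ (crossᴾ 𝕒 𝕓) 𝕔 1F) (𝕓 1F :* dotᴾ 𝕒 𝕔 :- 𝕒 1F :* dotᴾ 𝕓 𝕔) refl
  cross-cross u v w 2F = prove (coordinates ⟨ u ∣ v ∣ w ⟩)
    (crossᴾ (crossᴾ 𝕒 𝕓) 𝕔 2F) (𝕓 2F :* dotᴾ 𝕒 𝕔 :- 𝕒 2F :* dotᴾ 𝕓 𝕔) refl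

  lagrange : ∀ u v w x →
    dot (cross u (cross v w)) x ≈ dot u w * dot v x - dot u v * dot w x
  lagrange u v w x = prove (coordinates ⟨ u ∣ v ∣ w ∣ x ⟩)
    (dotᴾ (crossᴾ 𝕒 (crossᴾ 𝕓 𝕔)) 𝕕)
    (dotᴾ 𝕒 𝕔 :* dotᴾ 𝕓 𝕕 :- dotᴾ 𝕒 𝕓 :* dotᴾ 𝕔 𝕕) refl

  -- Every factor on the right pairs an edge of one triangle with a vertex of the other, so a
  -- collapsed edge kills a term.
  concurrency-expansion : ∀ a a′ b b′ c c′ →
    dot (cross (cross a a′) (cross b b′)) (cross c c′)
      ≈ dot (cross a′ b′) a * dot (cross b c) c′ - dot (cross a b) a′ * dot (cross b′ c′) c
  concurrency-expansion a a′ b b′ c c′ = begin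
    dot (cross u (cross b b′)) w                   ≈⟨ lagrange u b b′ w ⟩
    dot u b′ * dot b w - dot u b * dot b′ w        ≈⟨ +-cong
      (*-cong (dot-cross-cycle a a′ b′) (trans (dot-comm b w) (sym (dot-cross-cycle b c c′))))
      (-‿cong (*-cong (dot-cross-swap a a′ b)
        (trans (trans (dot-comm b′ w) (sym (dot-cross-cycle b′ c c′))) (dot-cross-swap b′ c c′)))) ⟩
    x * y - - z * - t                              ≈⟨ +-congˡ (-‿cong
      (solve 2 (λ z t → :- z :* :- t := z :* t) refl z t)) ⟩
    x * y - z * t                                  ∎
    where
    u = cross a a′
    w = cross c c′
    x = dot (cross a′ b′) a
    y = dot (cross b c) c′
    z = dot (cross a b) a′
    t = dot (cross b′ c′) c

  -- Desargues' theorem and its converse as one polynomial identity: the determinants of the two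
  -- triangles can be cancelled when both are proper.
  desargues-identity : ∀ a b c a′ b′ c′ →
    dot (cross a b) c * dot (cross a′ b′) c′
      * dot (cross (cross a a′) (cross b b′)) (cross c c′)
      ≈ - dot (cross (cross (cross a b) (cross a′ b′)) (cross (cross a c) (cross a′ c′)))
              (cross (cross b c) (cross b′ c′))
  desargues-identity a b c a′ b′ c′ = begin
    Δ * Δ′ * dot (cross (cross a a′) (cross b b′)) (cross c c′)
      ≈⟨ *-congˡ (concurrency-expansion a a′ b b′ c c′) ⟩
    Δ * Δ′ * (x * y - z * t)
      ≈⟨ solve 6 (λ Δ Δ′ x y z t →
           Δ :* Δ′ :* (x :* y :- z :* t)
             := :- (Δ′ :* z :* (Δ :* t) :- :- (Δ :* x) :* :- (Δ′ :* y))) refl Δ Δ′ x y z t ⟩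
    -- Each triangle determinant times one of `x`, `y`, `z`, `t` is, up to sign, the dot product of
    -- `p` or `w` with `l₃` or `l₃′`; `lagrange` then reassembles the four. Each solver call
    -- involves only four vectors.
    - (Δ′ * z * (Δ * t) - - (Δ * x) * - (Δ′ * y))
      ≈⟨ -‿cong (+-cong
        (*-cong
          (prove (coordinates ⟨ a′ ∣ b′ ∣ c′ ∣ l₁ ⟩)
            (dotᴾ (crossᴾ 𝕒 𝕓) 𝕔 :* dotᴾ 𝕕 𝕒) (dotᴾ (crossᴾ 𝕕 (crossᴾ 𝕒 𝕓)) (crossᴾ 𝕒 𝕔)) refl)
          (prove (coordinates ⟨ a ∣ b ∣ c ∣ l₂′ ⟩)
            (dotᴾ (crossᴾ 𝕒 𝕓) 𝕔 :* dotᴾ 𝕕 𝕔) (dotᴾ (crossᴾ 𝕒 𝕔) (crossᴾ (crossᴾ 𝕓 𝕔) 𝕕)) refl))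
        (-‿cong (*-cong
          (prove (coordinates ⟨ a ∣ b ∣ c ∣ l₁′ ⟩)
            (:- (dotᴾ (crossᴾ 𝕒 𝕓) 𝕔 :* dotᴾ 𝕕 𝕒)) (dotᴾ (crossᴾ (crossᴾ 𝕒 𝕓) 𝕕) (crossᴾ 𝕒 𝕔)) refl)
          (prove (coordinates ⟨ a′ ∣ b′ ∣ c′ ∣ l₂ ⟩)
            (:- (dotᴾ (crossᴾ 𝕒 𝕓) 𝕔 :* dotᴾ 𝕕 𝕔)) (dotᴾ (crossᴾ 𝕒 𝕔) (crossᴾ 𝕕 (crossᴾ 𝕓 𝕔))) refl)))) ⟩
    - (dot p l₃′ * dot l₃ w - dot p l₃ * dot l₃′ w)
      ≈⟨ -‿cong (lagrange p l₃ l₃′ w) ⟨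
    - dot (cross p (cross l₃ l₃′)) w               ∎
    where
    l₁  = cross a b
    l₂  = cross b c
    l₃  = cross a c
    l₁′ = cross a′ b′
    l₂′ = cross b′ c′
    l₃′ = cross a′ c′
    p   = cross l₁ l₁′
    w   = cross l₂ l₂′
    Δ   = dot l₁ c
    Δ′  = dot l₁′ c′
    x   = dot l₁′ a
    y   = dot l₂ c′
    z   = dot l₁ a′
    t   = dot l₂′ c

  -- By tightness, being zero is stable under double negation, so that it may be
  -- proved by cases although apartness is not decidable.
  by-apartness : ∀ x {y} → (x # 0# → y ≈ 0#) → (x ≈ 0# → y ≈ 0#) → y ≈ 0#
  by-apartness x {y} if-apart if-zero = proj₁ (tight y 0#) λ y#0 →
    proj₂ (tight y 0#)
      (if-zero (proj₁ (tight x 0#) λ x#0 → proj₂ (tight y 0#) (if-apart x#0) y#0)) y#0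

  #0-inverse : ∀ {x} → x # 0# → ∃[ x⁻¹ ] x⁻¹ * x ≈ 1#
  #0-inverse {x} x#0 with x⁻¹ , eq , _ ← #⇒invertible x#0 =
    x⁻¹ , trans (*-congˡ (sym (x-0≈x x))) eq

  *-cancel-zeroˡ : ∀ {x y} → x # 0# → x * y ≈ 0# → y ≈ 0#
  *-cancel-zeroˡ {x} {y} x#0 xy≈0 with x⁻¹ , eq ← #0-inverse x#0 = begin
    y              ≈⟨ *-identityˡ y ⟨
    1# * y         ≈⟨ *-congʳ eq ⟨
    x⁻¹ * x * y    ≈⟨ *-assoc x⁻¹ x y ⟩
    x⁻¹ * (x * y)  ≈⟨ *-congˡ xy≈0 ⟩
    x⁻¹ * 0#       ≈⟨ zeroʳ x⁻¹ ⟩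
    0#             ∎

  -x≈0 : ∀ {x} → x ≈ 0# → - x ≈ 0#
  -x≈0 x≈0 = trans (-‿cong x≈0) ε⁻¹≈ε

  x*0≈0 : ∀ {x y} → y ≈ 0# → x * y ≈ 0#
  x*0≈0 y≈0 = trans (*-congˡ y≈0) (zeroʳ _)

  0*x≈0 : ∀ {x y} → x ≈ 0# → x * y ≈ 0#
  0*x≈0 x≈0 = trans (*-congʳ x≈0) (zeroˡ _)

  0-0≈0 : ∀ {x y} → x ≈ 0# → y ≈ 0# → x - y ≈ 0#
  0-0≈0 x≈0 y≈0 = trans (+-cong x≈0 (-x≈0 y≈0)) (+-identityʳ 0#)

  0+0≈0 : ∀ {x y} → x ≈ 0# → y ≈ 0# → x + y ≈ 0#
  0+0≈0 x≈0 y≈0 = trans (+-cong x≈0 y≈0) (+-identityʳ 0#)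

  Null : Vec³ → Set ℓ₁
  Null u = ∀ i → u i ≈ 0#

  -- By tightness, a vector that is not `Nonzero` is zero in every coordinate.
  by-apartnessᵛ : ∀ u {y} → (Nonzero u → y ≈ 0#) → (Null u → y ≈ 0#) → y ≈ 0#
  by-apartnessᵛ u {y} if-nonzero if-null = proj₁ (tight y 0#) λ y#0 →
    proj₂ (tight y 0#)
      (if-null λ i → proj₁ (tight (u i) 0#) λ uᵢ#0 →
        proj₂ (tight y 0#) (if-nonzero (i , uᵢ#0)) y#0) y#0

  cross-null-sym : ∀ u v → Null (cross u v) → Null (cross v u)
  cross-null-sym u v null i = trans (cross-anticomm v u i) (-x≈0 (null i))

  dot-nullˡ : ∀ {u} v → Null u → dot u v ≈ 0#
  dot-nullˡ v null = 0+0≈0 (0+0≈0 (0*x≈0 (null 0F)) (0*x≈0 (null 1F))) (0*x≈0 (null 2F))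

  -- Proportional vectors and incidence.

  infix 4 _∝_
  -- The factor may be zero, so the relation is not symmetric; this covers joins and meets that
  -- collapse to the null vector.
  _∝_ : Vec³ → Vec³ → Set (c ⊔ ℓ₁)
  u ∝ v = ∃[ t ] ∀ i → u i ≈ t * v i

  dot-congˡ : ∀ u {v w} → (∀ i → v i ≈ w i) → dot u v ≈ dot u w
  dot-congˡ u eq = +-cong (+-cong (*-congˡ (eq 0F)) (*-congˡ (eq 1F))) (*-congˡ (eq 2F))

  dot-scaleʳ : ∀ u {v w} t → (∀ i → v i ≈ t * w i) → dot u v ≈ t * dot u w
  dot-scaleʳ u {v} {w} t eq = trans (dot-congˡ u eq)
    (solve 7 (λ t u₀ u₁ u₂ w₀ w₁ w₂ →
        u₀ :* (t :* w₀) :+ u₁ :* (t :* w₁) :+ u₂ :* (t :* w₂)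
          := t :* (u₀ :* w₀ :+ u₁ :* w₁ :+ u₂ :* w₂))
      refl t (u 0F) (u 1F) (u 2F) (w 0F) (w 1F) (w 2F))

  dot-scaleˡ : ∀ u {v w} t → (∀ i → v i ≈ t * w i) → dot v u ≈ t * dot w u
  dot-scaleˡ u {v} {w} t eq =
    trans (dot-comm v u) (trans (dot-scaleʳ u t eq) (*-congˡ (dot-comm u w)))

  dot-∝ʳ : ∀ u {v w} → v ∝ w → dot u w ≈ 0# → dot u v ≈ 0#
  dot-∝ʳ u (t , eq) uw≈0 = trans (dot-scaleʳ u t eq) (x*0≈0 uw≈0)

  dot-∝ˡ : ∀ u {v w} → v ∝ w → dot w u ≈ 0# → dot v u ≈ 0#
  dot-∝ˡ u (t , eq) wu≈0 = trans (dot-scaleˡ u t eq) (x*0≈0 wu≈0)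

  -- The determinant is linear in each argument; cyclic shifts bring them to the last place in turn.
  dot-cross-∝ : ∀ a b c {u v w} → u ∝ a → v ∝ b → w ∝ c →
    dot (cross a b) c ≈ 0# → dot (cross u v) w ≈ 0#
  dot-cross-∝ a b c {u} {v} {w} u∝a v∝b w∝c abc≈0 =
    dot-∝ʳ (cross u v) w∝c
      (trans (dot-cross-cycle u v c)
        (dot-∝ʳ (cross v c) u∝a
          (trans (dot-cross-cycle v c a)
            (dot-∝ʳ (cross c a) v∝b
              (trans (dot-cross-cycle c a b) abc≈0)))))

  minors-vanish : ∀ u v → Null (cross u v) → ∀ i j → u i * v j ≈ u j * v i
  minors-vanish u v null 0F 0F = refl
  minors-vanish u v null 0F 1F = x∙y⁻¹≈ε⇒x≈y _ _ (null 2F)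
  minors-vanish u v null 0F 2F = sym (x∙y⁻¹≈ε⇒x≈y _ _ (null 1F))
  minors-vanish u v null 1F 0F = sym (x∙y⁻¹≈ε⇒x≈y _ _ (null 2F))
  minors-vanish u v null 1F 1F = refl
  minors-vanish u v null 1F 2F = x∙y⁻¹≈ε⇒x≈y _ _ (null 0F)
  minors-vanish u v null 2F 0F = x∙y⁻¹≈ε⇒x≈y _ _ (null 1F)
  minors-vanish u v null 2F 1F = sym (x∙y⁻¹≈ε⇒x≈y _ _ (null 0F))
  minors-vanish u v null 2F 2F = refl

  cross-null⇒∝ : ∀ u v → Nonzero v → Null (cross u v) → u ∝ v
  -- The factor is read off at the coordinate `j` where `v` is invertible.
  cross-null⇒∝ u v (j , vⱼ#0) null with v⁻¹ , eq ← #0-inverse vⱼ#0 = u j * v⁻¹ , λ i → begin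
    u i                    ≈⟨ *-identityˡ (u i) ⟨
    1# * u i               ≈⟨ *-congʳ eq ⟨
    v⁻¹ * v j * u i        ≈⟨ *-assoc v⁻¹ (v j) (u i) ⟩
    v⁻¹ * (v j * u i)      ≈⟨ *-congˡ (*-comm (v j) (u i)) ⟩
    v⁻¹ * (u i * v j)      ≈⟨ *-congˡ (minors-vanish u v null i j) ⟩
    v⁻¹ * (u j * v i)      ≈⟨ *-assoc v⁻¹ (u j) (v i) ⟨
    v⁻¹ * u j * v i        ≈⟨ *-congʳ (*-comm v⁻¹ (u j)) ⟩
    u j * v⁻¹ * v i        ∎

  ∝⇒minors-vanish : ∀ {u v w} → u ∝ w → v ∝ w → ∀ i j → u i * v j - u j * v i ≈ 0#
  ∝⇒minors-vanish {w = w} (s , u≈sw) (t , v≈tw) i j = trans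
    (+-cong (*-cong (u≈sw i) (v≈tw j)) (-‿cong (*-cong (u≈sw j) (v≈tw i))))
    (trans (+-congʳ (solve 4 (λ s t x y → s :* x :* (t :* y) := s :* y :* (t :* x))
                       refl s t (w i) (w j)))
           (-‿inverseʳ _))

  ∝⇒cross-null : ∀ {u v w} → u ∝ w → v ∝ w → Null (cross u v)
  ∝⇒cross-null {u} {v} u∝w v∝w 0F = ∝⇒minors-vanish {u} {v} u∝w v∝w 1F 2F
  ∝⇒cross-null {u} {v} u∝w v∝w 1F = ∝⇒minors-vanish {u} {v} u∝w v∝w 2F 0F
  ∝⇒cross-null {u} {v} u∝w v∝w 2F = ∝⇒minors-vanish {u} {v} u∝w v∝w 0F 1F

  ∝-refl : ∀ {u} → u ∝ u
  ∝-refl = 1# , λ i → sym (*-identityˡ _)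

  ∝-sym : ∀ {u v} → Nonzero u → u ∝ v → v ∝ u
  ∝-sym {u} {v} u≠0 u∝v =
    cross-null⇒∝ v u u≠0 (∝⇒cross-null {v} {u} {v} ∝-refl u∝v)

  nonzero-cross-sym : ∀ u v → Nonzero (cross u v) → Nonzero (cross v u)
  nonzero-cross-sym u v (i , #0) =
    i , #-congʳ (trans (-1*x≈-x _) (sym (cross-anticomm v u i))) (x#0y#0→xy#0 -1#0 #0)
    where
    -1#0 : - 1# # 0#
    -1#0 = invertibleˡ⇒# (- 1# , trans (*-congˡ (x-0≈x _)) (trans (-1*x≈-x _) (⁻¹-involutive 1#)))

  cross-∝-cross : ∀ u v → cross u v ∝ cross v u
  cross-∝-cross u v = - 1# , λ i →
    trans (cross-anticomm u v i) (sym (-1*x≈-x _))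

  -- By `cross-cross`, `cross u v` has null cross product with `w`. This identifies the join of two
  -- points on the line `w`, with factor zero if they coincide, and dually the meet of two lines.
  cross-∝ : ∀ u v w → Nonzero w → dot u w ≈ 0# → dot v w ≈ 0# → cross u v ∝ w
  cross-∝ u v w w≠0 uw≈0 vw≈0 = cross-null⇒∝ (cross u v) w w≠0 λ i →
    trans (cross-cross u v w i) (0-0≈0 (x*0≈0 uw≈0) (x*0≈0 vw≈0))

  collinear : ∀ u v x w → Nonzero w → dot u w ≈ 0# → dot v w ≈ 0# → dot x w ≈ 0# →
    dot (cross u v) x ≈ 0#
  collinear u v x w w≠0 uw≈0 vw≈0 xw≈0 =
    dot-∝ˡ x (cross-∝ u v w w≠0 uw≈0 vw≈0) (trans (dot-comm w x) xw≈0)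

  -- Both vectors are multiples of `cross l m`.
  meet-unique : ∀ {u v} l m → Nonzero (cross l m) → Nonzero v →
    dot u l ≈ 0# → dot u m ≈ 0# → dot v l ≈ 0# → dot v m ≈ 0# → u ∝ v
  meet-unique {u} {v} l m lm≠0 v≠0 ul≈0 um≈0 vl≈0 vm≈0 =
    cross-null⇒∝ u v v≠0 (∝⇒cross-null {u} {v} (on-meet u ul≈0 um≈0) (on-meet v vl≈0 vm≈0))
    where
    on-meet : ∀ x → dot x l ≈ 0# → dot x m ≈ 0# → x ∝ cross l m
    on-meet x xl≈0 xm≈0 = cross-null⇒∝ x (cross l m) lm≠0
      (cross-null-sym (cross l m) x λ i → trans (cross-cross l m x i)
        (0-0≈0 (x*0≈0 (trans (dot-comm l x) xl≈0)) (x*0≈0 (trans (dot-comm m x) xm≈0))))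

-- The converse of Desargues' theorem, with degenerate triangles.

module Desargues {c ℓ₁ ℓ₂} (F : HeytingField c ℓ₁ ℓ₂) where

  open HeytingField F
  open Pentagram F
  open VectorAlgebra F
  open HeytingCommutativeRingProperties heytingCommutativeRing using (x#0y#0→xy#0)

  -- A triangle ABC with points X, Y, Z on the sides AB, BC, AC. The sides are given
  -- separately because vertices may coincide: l₁ ♯ l₂ leaves A = B, B = C and A = B = C open.
  record Trilateral (A B C X Y Z : Point) (l₁ l₂ m : Line) : Set (ℓ₁ ⊔ ℓ₂) where
    field
      l₁♯l₂ : l₁ ♯ l₂
      A∈l₁  : A ∈ˡ l₁
      B∈l₁  : B ∈ˡ l₁
      X∈l₁  : X ∈ˡ l₁
      B∈l₂  : B ∈ˡ l₂
      C∈l₂  : C ∈ˡ l₂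
      Y∈l₂  : Y ∈ˡ l₂
      A∈m   : A ∈ˡ m
      C∈m   : C ∈ˡ m
      Z∈m   : Z ∈ˡ m

  reverse : ∀ {A B C X Y Z l₁ l₂ m} →
    Trilateral A B C X Y Z l₁ l₂ m → Trilateral C B A Y X Z l₂ l₁ m
  reverse {l₁ = l₁} {l₂} t = record
    { l₁♯l₂ = nonzero-cross-sym (coords l₁) (coords l₂) l₁♯l₂
    ; A∈l₁ = C∈l₂ ; B∈l₁ = B∈l₂ ; X∈l₁ = Y∈l₂
    ; B∈l₂ = B∈l₁ ; C∈l₂ = A∈l₁ ; Y∈l₂ = X∈l₁
    ; A∈m = C∈m ; C∈m = A∈m ; Z∈m = Z∈m
    }
    where open Trilateral t

  -- A determinant of vectors rather than of lines, so that it makes sense, and vanishes, when a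
  -- vertex coincides with its partner.
  concurrency : (A A′ B B′ C C′ : Point) → Carrier
  concurrency A A′ B B′ C C′ =
    dot (cross (cross (coords A) (coords A′)) (cross (coords B) (coords B′)))
        (cross (coords C) (coords C′))

  module _ {A B C A′ B′ C′ X Y Z : Point} {l₁ l₂ m l₁′ l₂′ m′ : Line} (n : Line)
    (t : Trilateral A B C X Y Z l₁ l₂ m) (t′ : Trilateral A′ B′ C′ X Y Z l₁′ l₂′ m′)
    (X∈n : X ∈ˡ n) (Y∈n : Y ∈ˡ n) (Z∈n : Z ∈ˡ n) where

    open Trilateral t
    open Trilateral t′ using () renaming
      ( l₁♯l₂ to l₁′♯l₂′
      ; A∈l₁ to A′∈l₁′; B∈l₁ to B′∈l₁′; X∈l₁ to X∈l₁′
      ; B∈l₂ to B′∈l₂′; C∈l₂ to C′∈l₂′; Y∈l₂ to Y∈l₂′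
      ; A∈m to A′∈m′; C∈m to C′∈m′; Z∈m to Z∈m′
      )

    private
      a = coords A
      b = coords B
      c₀ = coords C
      a′ = coords A′
      b′ = coords B′
      c₀′ = coords C′
      x = coords X
      y = coords Y
      z = coords Z

    -- With A = B the second term of `concurrency-expansion` is zero. `Product≈0` is the claim about
    -- the first: one factor vanishes if A lies on A′B′ or A′ = B′, the other if C′ lies on BC or B
    -- = C.
    degenerate-edge : Null (cross a b) → concurrency A A′ B B′ C C′ ≈ 0#
    degenerate-edge ab≈0 = trans (concurrency-expansion a a′ b b′ c₀ c₀′)
      (0-0≈0 (product≈0 (cross-∝ b c₀ (coords l₂) (nonzero l₂) B∈l₂ C∈l₂))
             (0*x≈0 (dot-nullˡ a′ ab≈0)))
      where
      Product≈0 : Set ℓ₁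
      Product≈0 = dot (cross a′ b′) a * dot (cross b c₀) c₀′ ≈ 0#

      a∝b : a ∝ b
      a∝b = cross-null⇒∝ a b (nonzero B) ab≈0

      b∝a : b ∝ a
      b∝a = cross-null⇒∝ b a (nonzero A) (cross-null-sym a b ab≈0)

      BCZ≈0 : dot (cross b c₀) z ≈ 0#
      BCZ≈0 = dot-cross-∝ a c₀ z b∝a (∝-refl {c₀}) (∝-refl {z})
        (collinear a c₀ z (coords m) (nonzero m) A∈m C∈m Z∈m)

      -- A and X are both the intersection of `l₁` and `l₂`, so A lies on `l₁′` with A′ and B′.
      X∈l₂⇒ : X ∈ˡ l₂ → Product≈0
      X∈l₂⇒ X∈l₂ = 0*x≈0 (dot-∝ʳ (cross a′ b′) a∝x
        (collinear a′ b′ x (coords l₁′) (nonzero l₁′) A′∈l₁′ B′∈l₁′ X∈l₁′))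
        where
        a∝x : a ∝ x
        a∝x = meet-unique (coords l₁) (coords l₂) l₁♯l₂ (nonzero X)
          A∈l₁ (dot-∝ˡ (coords l₂) a∝b B∈l₂) X∈l₁ X∈l₂

      -- Y = Z lies on `m′` and `l₂′`. If these lines differ, C′ is that point and so lies on `l₂`;
      -- if they agree, A′ and B′ are both the intersection of `l₁′` and `l₂′`.
      Y∝Z⇒ : cross b c₀ ∝ coords l₂ → y ∝ z → Product≈0
      Y∝Z⇒ bc∝l₂ y∝z = by-apartnessᵛ (cross (coords m′) (coords l₂′)) if-distinct if-equal
        where
        if-distinct : m′ ♯ l₂′ → Product≈0
        if-distinct m′♯l₂′ = x*0≈0 (dot-∝ˡ c₀′ bc∝l₂ (dot-∝ʳ (coords l₂) c′∝y
          (trans (dot-comm (coords l₂) y) Y∈l₂)))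
          where
          c′∝y : c₀′ ∝ y
          c′∝y = meet-unique (coords m′) (coords l₂′) m′♯l₂′ (nonzero Y)
            C′∈m′ C′∈l₂′ (dot-∝ˡ (coords m′) y∝z Z∈m′) Y∈l₂′

        if-equal : Null (cross (coords m′) (coords l₂′)) → Product≈0
        if-equal null = 0*x≈0 (dot-nullˡ a (∝⇒cross-null {a′} {b′} a′∝b′ (∝-refl {b′})))
          where
          l₂′∝m′ : coords l₂′ ∝ coords m′
          l₂′∝m′ = cross-null⇒∝ (coords l₂′) (coords m′) (nonzero m′)
            (cross-null-sym (coords m′) (coords l₂′) null)

          a′∝b′ : a′ ∝ b′
          a′∝b′ = meet-unique (coords l₁′) (coords l₂′) l₁′♯l₂′ (nonzero B′)
            A′∈l₁′ (dot-∝ʳ a′ l₂′∝m′ A′∈m′) B′∈l₁′ B′∈l₂′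

      -- Y and Z lie on both `n` and `l₂`: either they coincide, or `n` is `l₂` and contains X.
      Z∈l₂⇒ : cross b c₀ ∝ coords l₂ → Z ∈ˡ l₂ → Product≈0
      Z∈l₂⇒ bc∝l₂ Z∈l₂ = by-apartnessᵛ (cross (coords n) (coords l₂))
        (λ n♯l₂ → Y∝Z⇒ bc∝l₂
          (meet-unique (coords n) (coords l₂) n♯l₂ (nonzero Z) Y∈n Y∈l₂ Z∈n Z∈l₂))
        (λ null → X∈l₂⇒ (dot-∝ʳ x
          (cross-null⇒∝ (coords l₂) (coords n) (nonzero n)
            (cross-null-sym (coords n) (coords l₂) null)) X∈n))

      -- If `ν` is zero, so is the second factor. Otherwise `l₂` is the line BC, which is AC because
      -- A = B, and so contains Z.
      product≈0 : cross b c₀ ∝ coords l₂ → Product≈0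
      product≈0 bc∝l₂@(ν , eq) = by-apartness ν
        (λ ν#0 → Z∈l₂⇒ bc∝l₂ (trans (dot-comm z (coords l₂))
          (*-cancel-zeroˡ ν#0 (trans (sym (dot-scaleˡ z ν eq)) BCZ≈0))))
        (λ ν≈0 → x*0≈0 (trans (dot-scaleˡ c₀′ ν eq) (0*x≈0 ν≈0)))

  module _ {A B C A′ B′ C′ X Y Z : Point} {l₁ l₂ m l₁′ l₂′ m′ : Line} (n : Line)
    (t : Trilateral A B C X Y Z l₁ l₂ m) (t′ : Trilateral A′ B′ C′ X Y Z l₁′ l₂′ m′)
    (X∈n : X ∈ˡ n) (Y∈n : Y ∈ˡ n) (Z∈n : Z ∈ˡ n) where

    open Trilateral t

    private
      a = coords A
      b = coords B
      c₀ = coords C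
      a′ = coords A′
      b′ = coords B′
      c₀′ = coords C′

    -- Since `l₁` and `l₂` meet only in B, collinear vertices force A = B (`s` zero) or C = B (`s`
    -- apart from zero); the latter is the former for the reversed triangles.
    degenerate-triangle : dot (cross a b) c₀ ≈ 0# → concurrency A A′ B B′ C C′ ≈ 0#
    degenerate-triangle abc≈0 with s , eq ← cross-∝ a b (coords l₁) (nonzero l₁) A∈l₁ B∈l₁ =
      by-apartness s
        (λ s#0 → trans (dot-cross-reverse (cross a a′) (cross b b′) (cross c₀ c₀′))
          (-x≈0 (degenerate-edge n (reverse t) (reverse t′) Y∈n X∈n Z∈n
            (∝⇒cross-null {c₀} {b} (c∝b (C∈l₁ s#0)) (∝-refl {b})))))
        (λ s≈0 → degenerate-edge n t t′ X∈n Y∈n Z∈n λ i → trans (eq i) (0*x≈0 s≈0))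
      where
      C∈l₁ : s # 0# → C ∈ˡ l₁
      C∈l₁ s#0 = trans (dot-comm c₀ (coords l₁))
        (*-cancel-zeroˡ s#0 (trans (sym (dot-scaleˡ c₀ s eq)) abc≈0))

      c∝b : C ∈ˡ l₁ → c₀ ∝ b
      c∝b C∈l₁ = meet-unique (coords l₁) (coords l₂) l₁♯l₂ (nonzero B) C∈l₁ C∈l₂ B∈l₁ B∈l₂

  converse-desargues : ∀ {A B C A′ B′ C′ X Y Z : Point} {l₁ l₂ m l₁′ l₂′ m′ : Line} (n : Line) →
    Trilateral A B C X Y Z l₁ l₂ m → Trilateral A′ B′ C′ X Y Z l₁′ l₂′ m′ →
    X ∈ˡ n → Y ∈ˡ n → Z ∈ˡ n → concurrency A A′ B B′ C C′ ≈ 0#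
  converse-desargues {A} {B} {C} {A′} {B′} {C′} {X} {Y} {Z} {l₁} {l₂} {m} {l₁′} {l₂′} {m′}
    n t t′ X∈n Y∈n Z∈n =
    by-apartness (dot (cross a b) c₀)
      (λ Δ#0 → by-apartness (dot (cross a′ b′) c₀′)
        (λ Δ′#0 → *-cancel-zeroˡ (x#0y#0→xy#0 Δ#0 Δ′#0)
          (trans (desargues-identity a b c₀ a′ b′ c₀′) (-x≈0 axis)))
        -- Exchanging the two triangles only changes the sign of each joining line.
        (λ Δ′≈0 → dot-cross-∝ (cross a′ a) (cross b′ b) (cross c₀′ c₀)
          (cross-∝-cross a a′) (cross-∝-cross b b′) (cross-∝-cross c₀ c₀′)
          (degenerate-triangle n t′ t X∈n Y∈n Z∈n Δ′≈0)))
      (degenerate-triangle n t t′ X∈n Y∈n Z∈n)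
    where
    open Trilateral
    a = coords A
    b = coords B
    c₀ = coords C
    a′ = coords A′
    b′ = coords B′
    c₀′ = coords C′

    -- Corresponding sides both pass through `W`, so their meet is a multiple of it, with factor
    -- zero if they coincide.
    on-side : ∀ (U V U′ V′ W : Point) (l l′ : Line) → U ∈ˡ l → V ∈ˡ l → W ∈ˡ l →
      U′ ∈ˡ l′ → V′ ∈ˡ l′ → W ∈ˡ l′ →
      cross (cross (coords U) (coords V)) (cross (coords U′) (coords V′)) ∝ coords W
    on-side U V U′ V′ W l l′ U∈l V∈l W∈l U′∈l′ V′∈l′ W∈l′ = cross-∝
      (cross (coords U) (coords V)) (cross (coords U′) (coords V′)) (coords W) (nonzero W)
      (collinear (coords U) (coords V) (coords W) (coords l) (nonzero l) U∈l V∈l W∈l)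
      (collinear (coords U′) (coords V′) (coords W) (coords l′) (nonzero l′) U′∈l′ V′∈l′ W∈l′)

    axis : dot (cross (cross (cross a b) (cross a′ b′)) (cross (cross a c₀) (cross a′ c₀′)))
               (cross (cross b c₀) (cross b′ c₀′)) ≈ 0#
    axis = dot-cross-∝ (coords X) (coords Z) (coords Y)
      (on-side A B A′ B′ X l₁ l₁′ (A∈l₁ t) (B∈l₁ t) (X∈l₁ t) (A∈l₁ t′) (B∈l₁ t′) (X∈l₁ t′))
      (on-side A C A′ C′ Z m m′ (A∈m t) (C∈m t) (Z∈m t) (A∈m t′) (C∈m t′) (Z∈m t′))
      (on-side B C B′ C′ Y l₂ l₂′ (B∈l₂ t) (C∈l₂ t) (Y∈l₂ t) (B∈l₂ t′) (C∈l₂ t′) (Y∈l₂ t′))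
      (collinear (coords X) (coords Z) (coords Y) (coords n) (nonzero n) X∈n Z∈n Y∈n)

-- Addition of indices modulo n.

⊕-assoc : ∀ {n} (i : Fin n) a b → i ⊕ a ⊕ b ≡ i ⊕ (a ℕ.+ b)
⊕-assoc {n@(suc _)} i a b = toℕ-injective (begin
  toℕ (i ⊕ a ⊕ b)                          ≡⟨ toℕ-⊕ (i ⊕ a) b ⟩
  (toℕ (i ⊕ a) ℕ.+ b) % n                  ≡⟨ ≡.cong (λ x → (x ℕ.+ b) % n) (toℕ-⊕ i a) ⟩
  ((toℕ i ℕ.+ a) % n ℕ.+ b) % n            ≡⟨ %-distribˡ-+ ((toℕ i ℕ.+ a) % n) b n ⟩
  ((toℕ i ℕ.+ a) % n % n ℕ.+ b % n) % n    ≡⟨ ≡.cong (λ x → (x ℕ.+ b % n) % n)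
                                                (m%n%n≡m%n (toℕ i ℕ.+ a) n) ⟩
  ((toℕ i ℕ.+ a) % n ℕ.+ b % n) % n        ≡⟨ %-distribˡ-+ (toℕ i ℕ.+ a) b n ⟨
  (toℕ i ℕ.+ a ℕ.+ b) % n                  ≡⟨ ≡.cong (_% n) (ℕₚ.+-assoc (toℕ i) a b) ⟩
  (toℕ i ℕ.+ (a ℕ.+ b)) % n                ≡⟨ toℕ-⊕ i (a ℕ.+ b) ⟨
  toℕ (i ⊕ (a ℕ.+ b))                      ∎)
  where
  open ≡-Reasoning
  toℕ-⊕ : ∀ j k → toℕ (j ⊕ k) ≡ (toℕ j ℕ.+ k) % n
  toℕ-⊕ j k = toℕ-fromℕ< (m%n<n (toℕ j ℕ.+ k) n)

⊕-comm : ∀ {n} (i : Fin n) a b → i ⊕ a ⊕ b ≡ i ⊕ b ⊕ a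
⊕-comm i a b = ≡.trans (⊕-assoc i a b)
  (≡.trans (≡.cong (i ⊕_) (ℕₚ.+-comm a b)) (≡.sym (⊕-assoc i b a)))

-- Inscribed polygons under the pentagram map and its iterates.

module Iteration {c ℓ₁ ℓ₂} (F : HeytingField c ℓ₁ ℓ₂) {n : ℕ} (k : ℕ) where

  open HeytingField F
  open Pentagram F
  open VectorAlgebra F
  open Desargues F

  ⊕-k+1 : ∀ (i : Fin n) → i ⊕ (k ℕ.+ 1) ≡ i ⊕ 1 ⊕ k
  ⊕-k+1 i = ≡.sym (≡.trans (⊕-comm i 1 k) (⊕-assoc i k 1))

  diagonal : (P : Polygon n) → Defined k P → Polygon n
  diagonal P d i = join (P i) (P (i ⊕ k)) (DefinedAt.ends₀ (d i))

  module _ (P : Polygon n) (d : Defined k P) (i : Fin n) where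

    -- By `⊕-k+1` the second line in `T` is the next diagonal. Only coordinates are compared, as the
    -- two lines carry different proofs of nondegeneracy.
    coords-T : coords (T k P d i) ≡ cross (coords (diagonal P d i)) (coords (diagonal P d (i ⊕ 1)))
    coords-T = ≡.cong
      (λ j → cross (coords (diagonal P d i)) (cross (coords (P (i ⊕ 1))) (coords (P j)))) (⊕-k+1 i)

    diagonals-distinct : diagonal P d i ♯ diagonal P d (i ⊕ 1)
    diagonals-distinct = ≡.subst Nonzero coords-T (DefinedAt.distinct (d i))

    T∈diagonal : T k P d i ∈ˡ diagonal P d i
    T∈diagonal = ≡.subst (λ u → dot u l ≈ 0#) (≡.sym coords-T)
      (trans (dot-comm (cross l m) l) (dot-crossˡ l m))
      where
      l = coords (diagonal P d i)
      m = coords (diagonal P d (i ⊕ 1))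

    T∈next-diagonal : T k P d i ∈ˡ diagonal P d (i ⊕ 1)
    T∈next-diagonal = ≡.subst (λ u → dot u m ≈ 0#) (≡.sym coords-T)
      (trans (dot-comm (cross l m) m) (dot-crossʳ l m))
      where
      l = coords (diagonal P d i)
      m = coords (diagonal P d (i ⊕ 1))

    start∈diagonal : P i ∈ˡ diagonal P d i
    start∈diagonal = dot-crossˡ (coords (P i)) (coords (P (i ⊕ k)))

    end∈diagonal : P (i ⊕ k) ∈ˡ diagonal P d i
    end∈diagonal = dot-crossʳ (coords (P i)) (coords (P (i ⊕ k)))

  side-of-T : ∀ P (d : Defined k P) i →
    cross (coords (T k P d i)) (coords (T k P d (i ⊕ 1))) ∝ coords (diagonal P d (i ⊕ 1))
  side-of-T P d i = cross-∝ (coords (T k P d i)) (coords (T k P d (i ⊕ 1)))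
    (coords (diagonal P d (i ⊕ 1))) (nonzero (diagonal P d (i ⊕ 1)))
    (T∈next-diagonal P d i) (T∈diagonal P d (i ⊕ 1))

  -- `X`, `Y`, `Z` are left open so that both triangles of the perspectivity, at `i` and at `i ⊕ k`,
  -- are instances.
  trilateral : ∀ P Q (dP : Defined k P) (dQ : Defined k Q) {X Y Z} i →
    (∀ j → T k Q dQ j ∈ˡ diagonal P dP (j ⊕ 1)) →
    X ∈ˡ diagonal P dP (i ⊕ 1) → Y ∈ˡ diagonal P dP (i ⊕ 1 ⊕ 1) → Z ∈ˡ diagonal Q dQ (i ⊕ 1) →
    Trilateral (T k Q dQ i) (T k P dP (i ⊕ 1)) (T k Q dQ (i ⊕ 1)) X Y Z
      (diagonal P dP (i ⊕ 1)) (diagonal P dP (i ⊕ 1 ⊕ 1)) (diagonal Q dQ (i ⊕ 1))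
  trilateral P Q dP dQ i inscribed X∈l₁ Y∈l₂ Z∈m = record
    { l₁♯l₂ = diagonals-distinct P dP (i ⊕ 1)
    ; A∈l₁  = inscribed i
    ; B∈l₁  = T∈diagonal P dP (i ⊕ 1)
    ; X∈l₁  = X∈l₁
    ; B∈l₂  = T∈next-diagonal P dP (i ⊕ 1)
    ; C∈l₂  = inscribed (i ⊕ 1)
    ; Y∈l₂  = Y∈l₂
    ; A∈m   = T∈next-diagonal Q dQ i
    ; C∈m   = T∈diagonal Q dQ (i ⊕ 1)
    ; Z∈m   = Z∈m
    }

  inscribed-T² : ∀ (P Q : Polygon n) (dP : Defined k P) (dQ : Defined k Q)
    (dP′ : Defined k (T k P dP)) (dQ′ : Defined k (T k Q dQ)) →
    HasSides (T k (T k P dP) dP′) → Inscribed Q P → Inscribed (T k Q dQ) (T k P dP) →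
    Inscribed (T k (T k Q dQ) dQ′) (T k (T k P dP) dP′)
  inscribed-T² P Q dP dQ dP′ dQ′ sides″ (sides , Q∈P) (sides′ , Q′∈P′) =
    sides″ , λ i → dot-∝ʳ (coords (Q″ i)) (side-of-T P′ dP′ i) (Q″∈diagonal i)
    where
    P′ Q′ Q″ : Polygon n
    P′ = T k P dP
    Q′ = T k Q dQ
    Q″ = T k Q′ dQ′

    Q′∈diagonal : ∀ j → Q′ j ∈ˡ diagonal P dP (j ⊕ 1)
    -- The side of `P′` is nonzero by `sides′`, so the proportionality of `side-of-T` can be
    -- inverted.
    Q′∈diagonal j = dot-∝ʳ (coords (Q′ j)) (∝-sym (sides′ j) (side-of-T P dP j)) (Q′∈P′ j)

    module _ (i : Fin n) where

      j : Fin n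
      -- This bracketing fits the triangle at `i ⊕ k` definitionally; for the one at `i`, `j≡`
      -- transports the indices.
      j = i ⊕ k ⊕ 1

      j≡ : i ⊕ 1 ⊕ k ≡ j
      j≡ = ⊕-comm i 1 k

      X∈ : P j ∈ˡ diagonal P dP (i ⊕ 1)
      X∈ = ≡.subst (λ h → P h ∈ˡ diagonal P dP (i ⊕ 1)) j≡ (end∈diagonal P dP (i ⊕ 1))

      Y∈ : P (j ⊕ 1) ∈ˡ diagonal P dP (i ⊕ 1 ⊕ 1)
      Y∈ = ≡.subst (λ h → P h ∈ˡ diagonal P dP (i ⊕ 1 ⊕ 1))
        (≡.trans (⊕-comm (i ⊕ 1) 1 k) (≡.cong (_⊕ 1) j≡)) (end∈diagonal P dP (i ⊕ 1 ⊕ 1))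

      Z∈ : Q j ∈ˡ diagonal Q dQ (i ⊕ 1)
      Z∈ = ≡.subst (λ h → Q h ∈ˡ diagonal Q dQ (i ⊕ 1)) j≡ (end∈diagonal Q dQ (i ⊕ 1))

      concurrent : concurrency (Q′ i) (Q′ (i ⊕ k)) (P′ (i ⊕ 1)) (P′ j) (Q′ (i ⊕ 1)) (Q′ j) ≈ 0#
      concurrent = converse-desargues {X = P j} {P (j ⊕ 1)} {Q j} (join (P j) (P (j ⊕ 1)) (sides j))
        (trilateral P Q dP dQ i Q′∈diagonal X∈ Y∈ Z∈)
        -- The same three points that end the diagonals at `i` start those at `i ⊕ k`.
        (trilateral P Q dP dQ (i ⊕ k) Q′∈diagonal
          (start∈diagonal P dP j) (start∈diagonal P dP (j ⊕ 1)) (start∈diagonal Q dQ j))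
        (dot-crossˡ (coords (P j)) (coords (P (j ⊕ 1))))
        (dot-crossʳ (coords (P j)) (coords (P (j ⊕ 1))))
        (Q∈P j)

      Q″∈diagonal : Q″ i ∈ˡ diagonal P′ dP′ (i ⊕ 1)
      Q″∈diagonal = ≡.subst (λ u → dot u p ≈ 0#) (≡.sym (coords-T Q′ dQ′ i))
        -- `concurrency` has the diagonal of `P′` in the middle; moving it last costs a sign.
        (trans (dot-cross-swap q q₁ p) (-x≈0
          (≡.subst (λ h → concurrency (Q′ i) (Q′ (i ⊕ k)) (P′ (i ⊕ 1)) (P′ h) (Q′ (i ⊕ 1)) (Q′ h) ≈ 0#)
            (≡.sym j≡) concurrent)))
        where
        p  = coords (diagonal P′ dP′ (i ⊕ 1))
        q  = coords (diagonal Q′ dQ′ i)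
        q₁ = coords (diagonal Q′ dQ′ (i ⊕ 1))

  -- Induction along the orbit: the invariant is inscription at two consecutive iterates, which
  -- `inscribed-T²` shifts by one.
  inscribed-T^ : ∀ m (P Q : Polygon n) (dP : Defined k P) (dQ : Defined k Q) →
    Inscribed Q P → Inscribed (T k Q dQ) (T k P dP) →
    (gP : Generic k (suc m) P) (dQᵐ : Defined^ k (suc m) Q) →
    Inscribed (T^ k (suc m) Q dQᵐ) (T^ k (suc m) P (defined gP))
  -- The proofs of definedness in the hypothesis and the goal may differ, but `Inscribed` sees only
  -- coordinates, which do not depend on them.
  inscribed-T^ zero    P Q dP dQ Q⊂P Q′⊂P′ gP dQᵐ = Q′⊂P′
  inscribed-T^ (suc m) P Q _ _ Q⊂P Q′⊂P′
    record { defined = (dP , dP′ , ds) ; sides = sides } (dQ , dQ′ , es) =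
    inscribed-T^ m (T k P dP) (T k Q dQ) dP′ dQ′ Q′⊂P′
      (inscribed-T² P Q dP dQ dP′ dQ′ (sides 2 (s≤s (s≤s z≤n)) (dP , dP′ , _)) Q⊂P Q′⊂P′)
      record { defined = dP′ , ds ; sides = λ j j≤m d → sides (suc j) (s≤s j≤m) (dP , d) }
      (dQ′ , es)

theorem6 : ∀ {c ℓ₁ ℓ₂} (F : HeytingField c ℓ₁ ℓ₂) → let open Pentagram F in
    (n k : ℕ) → 5 ≤ n → 2 ≤ k → k ≤ n ∸ 2 →
    (P Q : Polygon n) (dP : Defined k P) (dQ : Defined k Q) →
    Inscribed Q P → Inscribed (T k Q dQ) (T k P dP) →
    ((gP : Generic k 2 P) (dQ² : Defined^ k 2 Q) →
      Inscribed (T^ k 2 Q dQ²) (T^ k 2 P (defined gP)))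
    ×
    (∀ m → 1 ≤ m → (gP : Generic k m P) (dQᵐ : Defined^ k m Q) →
      Inscribed (T^ k m Q dQᵐ) (T^ k m P (defined gP)))
theorem6 F n k _ _ _ P Q dP dQ Q⊂P Q′⊂P′ =
  -- `inscribed-T^` concerns the iterate `suc m`, so `1` yields the second one.
  inscribed-T^ 1 P Q dP dQ Q⊂P Q′⊂P′ ,
  λ { (suc m) _ → inscribed-T^ m P Q dP dQ Q⊂P Q′⊂P′ }
  where open Iteration F {n} k
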